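{- Let $X \in \{\mathrm{LD}, \mathrm{LTD}\}$, let $G$ be an X-admissible graph of order $n$, and let $k = \lfloor \log_2 n \rfloor \ge 2$. Then $\gamma^{X}(G) = k$ if and only if $G$ can be obtained (up to isomorphism) from some graph $G^L(k) = (C \cup (V\setminus C), E)$ for which $G^L(k)[C]$ is X-admissible, by removing up to $k-1$ vertices of $V \setminus C$.
   Context: Graphs are finite, simple and undirected. For a graph $G=(V,E)$ and $v\in V$, $N(v)$ is the open neighborhood and $N[v]=N(v)\cup\{v\}$ the closed neighborhood; $G[C]$ is the subgraph induced by $C$. A set $C\subseteq V$ is dominating (resp. total-dominating) if $N[v]\cap C\neq\emptyset$ (resp. $N(v)\cap C\ne\emptyset$) for all $v\in V$. A set $C$ is location-separating if $N(u)\cap C\neq N(v)\cap C$ for all distinct $u,v\in V\setminus C$. An LD-code (resp. LTD-code) is a set that is location-separating and dominating (resp. total-dominating). A graph is X-admissible if it has an X-code (every graph is LD-admissible; a graph is LTD-admissible iff it has no isolated vertex); $\gamma^{X}(G)$ is the minimum cardinality of an X-code of $G$. For $k\ge 2$, $G^L(k)$ denotes any graph with vertex set $V$ and a subset $C\subseteq V$ such that $|C|=k$ and $V\setminus C$ consists of exactly one vertex $v_{C'}$ with $N(v_{C'})\cap C=C'$ for each non-empty subset $C'\subseteq C$; there is no condition on the edges inside $C$ or inside $V\setminus C$. -}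

module Defs where

open import Data.Bool.Base using (Bool; true; false)
open import Data.Bool.Properties as Bool using ()
open import Data.Fin.Base using (Fin; zero; suc)
open import Data.Fin.Properties as Fin using (all?)
open import Data.Fin.Subset
open import Data.Fin.Subset.Properties using (_∈?_; nonempty?; anySubset?)
open import Data.Nat.Base using (ℕ; _≤_; _<_; _∸_)
open import Data.Nat.Induction using (<-wellFounded)
open import Data.Nat.Properties using (_<?_; ≮⇒≥)
open import Data.Product using (Σ; ∃; ∃!; _×_; _,_; proj₁)
open import Data.Vec.Base using (_∷_; tabulate)
open import Data.Vec.Properties using (≡-dec)
open import Function.Bundles using (_↔_; Inverse)
open import Induction.WellFounded using (Acc; acc)
open import Relation.Binary.PropositionalEquality using (_≡_; _≢_; refl)
open import Relation.Nullary using (Dec; yes; no; ¬?; _×-dec_; _→-dec_)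

private
  variable
    m n : ℕ

record Graph (n : ℕ) : Set where
  field
    adj    : Fin n → Fin n → Bool
    symm   : ∀ u v → adj u v ≡ adj v u
    irrefl : ∀ v → adj v v ≡ false

open Graph public

N : Graph n → Fin n → Subset n
N G v = tabulate (adj G v)

N[_] : Graph n → Fin n → Subset n
N[ G ] v = ⁅ v ⁆ ∪ N G v

record _≅_ (G : Graph m) (H : Graph n) : Set where
  field
    vertices : Fin m ↔ Fin n
    preserve : ∀ u v →
      adj H (Inverse.to vertices u) (Inverse.to vertices v) ≡ adj G u v

infix 4 _≅_

-- The increasing enumeration of the elements of a subset.
element : (C : Subset n) → Fin ∣ C ∣ → Fin n
element (outside ∷ C) i       = suc (element C i)
element (inside  ∷ C) zero    = zero
element (inside  ∷ C) (suc i) = suc (element C i)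

induced : Graph n → (C : Subset n) → Graph ∣ C ∣
induced G C = record
  { adj    = λ i j → adj G (element C i) (element C j)
  ; symm   = λ i j → symm G (element C i) (element C j)
  ; irrefl = λ i → irrefl G (element C i)
  }

remove : (G : Graph n) (R : Subset n) → Graph ∣ ∁ R ∣
remove G R = induced G (∁ R)

Dominating : Graph n → Subset n → Set
Dominating G C = ∀ v → Nonempty (N[ G ] v ∩ C)

TotalDominating : Graph n → Subset n → Set
TotalDominating G C = ∀ v → Nonempty (N G v ∩ C)

LocationSeparating : Graph n → Subset n → Set
LocationSeparating G C =
  ∀ u v → u ∉ C → v ∉ C → u ≢ v → N G u ∩ C ≢ N G v ∩ C

data Kind : Set where
  LD LTD : Kind

IsCode : Kind → Graph n → Subset n → Set
IsCode LD  G C = LocationSeparating G C × Dominating G C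
IsCode LTD G C = LocationSeparating G C × TotalDominating G C

Admissible : Kind → Graph n → Set
Admissible X G = ∃ λ C → IsCode X G C

locationSeparating? : (G : Graph n) (C : Subset n) → Dec (LocationSeparating G C)
locationSeparating? G C = all? λ u → all? λ v →
  ¬? (u ∈? C) →-dec (¬? (v ∈? C) →-dec
    (¬? (u Fin.≟ v) →-dec ¬? (≡-dec Bool._≟_ (N G u ∩ C) (N G v ∩ C))))

isCode? : (X : Kind) (G : Graph n) (C : Subset n) → Dec (IsCode X G C)
isCode? LD  G C =
  locationSeparating? G C ×-dec all? λ v → nonempty? (N[ G ] v ∩ C)
isCode? LTD G C =
  locationSeparating? G C ×-dec all? λ v → nonempty? (N G v ∩ C)

IsMinimumCodeSize : Kind → Graph n → ℕ → Set
IsMinimumCodeSize X G k =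
  (∃ λ C → IsCode X G C × ∣ C ∣ ≡ k) × (∀ C → IsCode X G C → k ≤ ∣ C ∣)

minimumCodeSize : (X : Kind) (G : Graph n) → Admissible X G →
                  ∃ λ k → IsMinimumCodeSize X G k
minimumCodeSize X G (C₀ , code₀) = search C₀ code₀ (<-wellFounded ∣ C₀ ∣)
  where
  search : ∀ C → IsCode X G C → Acc _<_ ∣ C ∣ → ∃ λ k → IsMinimumCodeSize X G k
  search C code (acc rs)
    with anySubset? (λ D → isCode? X G D ×-dec (∣ D ∣ <? ∣ C ∣))
  ... | yes (D , code′ , D<C) = search D code′ (rs D<C)
  ... | no  none = ∣ C ∣ , (C , code , refl) ,
                   λ D code′ → ≮⇒≥ λ D<C → none (D , code′ , D<C)

γ : (X : Kind) (G : Graph n) → Admissible X G → ℕ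
γ X G adm = proj₁ (minimumCodeSize X G adm)

-- H is a graph G^L(k) with distinguished subset C.  The fields traced and
-- unique-trace together say that V ∖ C consists of exactly one vertex v
-- with N(v) ∩ C = C′ for each non-empty C′ ⊆ C, and of no other vertices.
record IsGL (k : ℕ) (H : Graph n) (C : Subset n) : Set where
  field
    size         : ∣ C ∣ ≡ k
    traced       : ∀ v → v ∉ C → Nonempty (N H v ∩ C)
    unique-trace : ∀ C′ → C′ ⊆ C → Nonempty C′ →
                   ∃! _≡_ λ v → v ∉ C × N H v ∩ C ≡ C′

ObtainableFromGL : Kind → ℕ → Graph n → Set
ObtainableFromGL X k G =
  ∃ λ m → Σ (Graph m) λ H → Σ (Subset m) λ C →
    IsGL k H C ×
    Admissible X (induced H C) ×
    Σ (Subset m) λ R → R ⊆ ∁ C × ∣ R ∣ ≤ k ∸ 1 × G ≅ remove H R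

{-# OPTIONS --safe #-}
-- If every vertex outside C has a non-empty trace on C and these traces are
-- pairwise distinct, then n − |C| + 1 ≤ 2^|C|.  As 2^k ≤ n, this forces every
-- code to have at least k vertices.  For a code C with exactly k vertices,
-- attaching one new vertex per missing trace completes G to a G^L(k) of order
-- 2^k − 1 + k, so at most 2^k − 1 + k − n ≤ k − 1 vertices are attached.
-- Conversely, C itself remains a code after the removal of vertices outside C;
-- for LTD this uses that C induces a graph without isolated vertices.
module Submission where

open import Defs
open import Data.Bool.Base using (Bool; true; false; _∧_)
import Data.Bool.Properties as Bool
open import Data.Fin.Base using (Fin; zero; suc; finToFun; funToFin)
import Data.Fin.Properties as Fin
open import Data.Fin.Subset
open import Data.Fin.Subset.Properties
open import Data.Nat using (ℕ; _≤_)
open import Data.Nat.Base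
  using (zero; suc; _+_; _*_; _∸_; _^_; _<_; z≤n; s≤s; z<s; ⌊_/2⌋; ⌈_/2⌉)
open import Data.Nat.Logarithm using (⌊log₂_⌋; ⌊log₂⌊n/2⌋⌋≡⌊log₂n⌋∸1)
import Data.Nat.Properties as ℕ
open import Data.Product using (Σ; ∃; _×_; _,_; proj₁; proj₂)
open import Data.Sum.Base using (inj₁; inj₂)
open import Data.Vec.Base using (_∷_; here; there; lookup; tabulate)
open import Data.Vec.Properties
  using (≡-dec; []=⇒lookup; lookup⇒[]=; lookup∘tabulate; lookup-zipWith;
         tabulate∘lookup; ∷-injectiveʳ)
open import Function.Base using (_∘_; case_of_)
open import Function.Bundles using (_⇔_; Inverse; mk⇔; mk↔ₛ′)
open import Function.Definitions using (Injective)
open import Relation.Binary.PropositionalEquality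
  using (_≡_; refl; sym; trans; cong; cong₂; subst)
open import Relation.Nullary
  using (Dec; yes; no; ¬_; ¬?; _×-dec_; contradiction)
open import Relation.Nullary.Decidable using (decidable-stable)

private
  variable
    m n : ℕ
    C : Subset n

-- Powers of two and the binary logarithm.

2^k≤1+n : ∀ k n → k ≤ ⌊log₂ suc n ⌋ → 2 ^ k ≤ suc n
2^k≤1+n zero    n       _   = s≤s z≤n
2^k≤1+n (suc k) zero    ()
2^k≤1+n (suc k) (suc n) k<l = begin
  2 * 2 ^ k                     ≤⟨ ℕ.*-monoʳ-≤ 2 (2^k≤1+n k ⌊ n /2⌋ k≤) ⟩
  2 * ⌊ 2 + n /2⌋               ≡⟨ cong (⌊ 2 + n /2⌋ +_) (ℕ.+-identityʳ _) ⟩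
  ⌊ 2 + n /2⌋ + ⌊ 2 + n /2⌋     ≤⟨ ℕ.+-monoʳ-≤ ⌊ 2 + n /2⌋ (ℕ.⌊n/2⌋≤⌈n/2⌉ (2 + n)) ⟩
  ⌊ 2 + n /2⌋ + ⌈ 2 + n /2⌉     ≡⟨ ℕ.⌊n/2⌋+⌈n/2⌉≡n (2 + n) ⟩
  2 + n                         ∎
  where
  open ℕ.≤-Reasoning
  -- Halving the argument lowers the logarithm by one, so the induction hypothesis applies at
  -- `⌊ 2 + n /2⌋`, which computes to `suc ⌊ n /2⌋`.
  k≤ : k ≤ ⌊log₂ ⌊ 2 + n /2⌋ ⌋
  k≤ = subst (k ≤_) (sym (⌊log₂⌊n/2⌋⌋≡⌊log₂n⌋∸1 (2 + n))) (ℕ.∸-monoˡ-≤ 1 k<l)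

-- The bound `1 ≤ k` rules out `n = 0`, where the logarithm is 0 by convention while `2 ^ 0` exceeds
-- `n`.
2^⌊log₂n⌋≤n : ∀ k n → k ≡ ⌊log₂ n ⌋ → 1 ≤ k → 2 ^ k ≤ n
2^⌊log₂n⌋≤n k (suc n) eq _ = 2^k≤1+n k n (ℕ.≤-reflexive eq)
2^⌊log₂n⌋≤n _ zero    refl ()

n<2^n : ∀ n → n < 2 ^ n
n<2^n zero    = s≤s z≤n
n<2^n (suc n) = begin-strict
  1 + n         ≤⟨ n<2^n n ⟩
  2 ^ n         <⟨ ℕ.m<m+n (2 ^ n) (ℕ.≤-trans z<s (n<2^n n)) ⟩
  2 ^ n + 2 ^ n ≡⟨ cong (2 ^ n +_) (ℕ.+-identityʳ _) ⟨
  2 ^ suc n     ∎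
  where open ℕ.≤-Reasoning

-- Enumeration of a subset, its inverse, and complements.

element-∈ : (C : Subset n) (i : Fin ∣ C ∣) → element C i ∈ C
element-∈ (outside ∷ C) i       = there (element-∈ C i)
element-∈ (inside  ∷ C) zero    = here
element-∈ (inside  ∷ C) (suc i) = there (element-∈ C i)

element-injective : (C : Subset n) → Injective _≡_ _≡_ (element C)
element-injective (outside ∷ C) eq = element-injective C (Fin.suc-injective eq)
element-injective (inside  ∷ C) {zero}  {zero}  _  = refl
element-injective (inside  ∷ C) {suc i} {suc j} eq =
  cong suc (element-injective C (Fin.suc-injective eq))

rank : {v : Fin n} → v ∈ C → Fin ∣ C ∣
rank {C = inside  ∷ C} here        = zero
rank {C = inside  ∷ C} (there v∈C) = suc (rank v∈C)
rank {C = outside ∷ C} (there v∈C) = rank v∈C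

element-rank : {v : Fin n} (v∈C : v ∈ C) → element C (rank v∈C) ≡ v
element-rank {C = inside  ∷ C} here        = refl
element-rank {C = inside  ∷ C} (there v∈C) = cong suc (element-rank v∈C)
element-rank {C = outside ∷ C} (there v∈C) = cong suc (element-rank v∈C)

∁-involutive : (C : Subset n) → ∁ (∁ C) ≡ C
∁-involutive C = ⊆-antisym
  (λ x∈ → x∉∁p⇒x∈p (x∈∁p⇒x∉p x∈))
  (λ x∈ → x∉p⇒x∈∁p (x∈p⇒x∉∁p x∈))

∣C∣+∣∁C∣≡n : (C : Subset n) → ∣ C ∣ + ∣ ∁ C ∣ ≡ n
∣C∣+∣∁C∣≡n C =
  trans (cong (∣ C ∣ +_) (∣∁p∣≡n∸∣p∣ C)) (ℕ.m+[n∸m]≡n (∣p∣≤n C))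

-- Neighbourhoods and traces.

∈N⁺ : ∀ (G : Graph n) {v w} → adj G v w ≡ true → w ∈ N G v
∈N⁺ G {v} {w} eq = lookup⇒[]= w _ (trans (lookup∘tabulate (adj G v) w) eq)

∈N⁻ : ∀ (G : Graph n) {v w} → w ∈ N G v → adj G v w ≡ true
∈N⁻ G {v} {w} w∈ = trans (sym (lookup∘tabulate (adj G v) w)) ([]=⇒lookup w∈)

trace-mono : ∀ (G : Graph n) (C : Subset n) {u v} →
  (∀ {w} → w ∈ C → adj G u w ≡ adj G v w) → N G u ∩ C ⊆ N G v ∩ C
trace-mono G C {u} same w∈ with x∈p∩q⁻ (N G u) C w∈
... | w∈N , w∈C = x∈p∩q⁺ (∈N⁺ G (trans (sym (same w∈C)) (∈N⁻ G w∈N)) , w∈C)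

trace-cong : ∀ (G : Graph n) (C : Subset n) {u v} →
  (∀ {w} → w ∈ C → adj G u w ≡ adj G v w) → N G u ∩ C ≡ N G v ∩ C
trace-cong G C same =
  ⊆-antisym (trace-mono G C same) (trace-mono G C (sym ∘ same))

lookup-trace : ∀ (G : Graph n) (C : Subset n) u {w} → w ∈ C →
  lookup (N G u ∩ C) w ≡ adj G u w
lookup-trace G C u {w} w∈C
  rewrite lookup-zipWith _∧_ w (N G u) C
        | []=⇒lookup w∈C
        | lookup∘tabulate (adj G u) w = Bool.∧-identityʳ _

trace-≡⇒adj-≡ : ∀ (G : Graph n) (C : Subset n) {u v} →
  N G u ∩ C ≡ N G v ∩ C → ∀ {w} → w ∈ C → adj G u w ≡ adj G v w
trace-≡⇒adj-≡ G C {u} {v} eq {w} w∈C =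
  trans (sym (lookup-trace G C u w∈C))
    (trans (cong (λ p → lookup p w) eq) (lookup-trace G C v w∈C))

neighbour⁺ : ∀ (G : Graph n) (C : Subset n) {v} w →
  w ∈ C → adj G v w ≡ true → Nonempty (N G v ∩ C)
neighbour⁺ G C w w∈C vw = w , x∈p∩q⁺ (∈N⁺ G vw , w∈C)

neighbour⁻ : ∀ (G : Graph n) (C : Subset n) {v} →
  Nonempty (N G v ∩ C) → ∃ λ w → w ∈ C × adj G v w ≡ true
neighbour⁻ G C {v} (w , w∈) with x∈p∩q⁻ (N G v) C w∈
... | w∈N , w∈C = w , w∈C , ∈N⁻ G w∈N

-- The common part of LD- and LTD-codes.

Traced : Graph n → Subset n → Set
Traced G C = ∀ v → v ∉ C → Nonempty (N G v ∩ C)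

-- Constrains only vertices outside `C`, so it serves both kinds at once. It amounts to being an
-- LD-code; an LTD-code also needs neighbours in `C` for the vertices of `C`.
Identifying : Graph n → Subset n → Set
Identifying G C = LocationSeparating G C × Traced G C

dominating⇒traced : (G : Graph n) (C : Subset n) → Dominating G C → Traced G C
dominating⇒traced G C dom v v∉C with dom v
... | w , w∈ with x∈p∩q⁻ (N[ G ] v) C w∈
... | w∈N[v] , w∈C with x∈p∪q⁻ ⁅ v ⁆ (N G v) w∈N[v]
... | inj₁ w∈⁅v⁆ = contradiction (subst (_∈ C) (x∈⁅y⁆⇒x≡y v w∈⁅v⁆) w∈C) v∉C
... | inj₂ w∈N   = w , x∈p∩q⁺ (w∈N , w∈C)

traced⇒dominating : (G : Graph n) (C : Subset n) → Traced G C → Dominating G C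
traced⇒dominating G C traced v with v ∈? C
... | yes v∈C = v , x∈p∩q⁺ (p⊆p∪q (N G v) (x∈⁅x⁆ v) , v∈C)
... | no  v∉C with traced v v∉C
... | w , w∈ with x∈p∩q⁻ (N G v) C w∈
... | w∈N , w∈C = w , x∈p∩q⁺ (q⊆p∪q ⁅ v ⁆ (N G v) w∈N , w∈C)

code⇒identifying : ∀ X (G : Graph n) (C : Subset n) → IsCode X G C → Identifying G C
code⇒identifying LD  G C (ls , dom) = ls , dominating⇒traced G C dom
code⇒identifying LTD G C (ls , dom) = ls , λ v _ → dom v

-- Counting traces.

-- The index zero stands for the empty trace, the others for the traces of the
-- vertices outside C.
signature : Graph n → (C : Subset n) → Fin (suc ∣ ∁ C ∣) → Fin ∣ C ∣ → Bool
signature G C zero    i = false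
signature G C (suc j) i = adj G (element (∁ C) j) (element C i)

module _ (G : Graph n) (C : Subset n) (identifying : Identifying G C) where

  signature-nonzero : ∀ j → ¬ (∀ i → false ≡ signature G C (suc j) i)
  signature-nonzero j eq
    with neighbour⁻ G C (proj₂ identifying (element (∁ C) j) (x∈∁p⇒x∉p (element-∈ (∁ C) j)))
  ... | w , w∈C , vw = case
    trans (eq (rank w∈C)) (trans (cong (adj G _) (element-rank w∈C)) vw) of λ ()

  -- Index zero differs from the rest because traces are non-empty; two vertices outside `C` with
  -- the same row would have the same trace, against location-separation.
  signature-injective : ∀ x y → (∀ i → signature G C x i ≡ signature G C y i) → x ≡ y
  signature-injective zero    zero    eq = refl
  signature-injective zero    (suc j) eq = contradiction eq (signature-nonzero j)
  signature-injective (suc i) zero    eq = contradiction (sym ∘ eq) (signature-nonzero i)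
  signature-injective (suc i) (suc j) eq = decidable-stable (suc i Fin.≟ suc j) λ i≢j →
    proj₁ identifying _ _ (outside-∁ i) (outside-∁ j)
      (i≢j ∘ cong suc ∘ element-injective (∁ C))
      (trace-cong G C λ w∈C →
        subst (λ w → adj G _ w ≡ adj G _ w) (element-rank w∈C) (eq (rank w∈C)))
    where
    outside-∁ : ∀ i → element (∁ C) i ∉ C
    outside-∁ i = x∈∁p⇒x∉p (element-∈ (∁ C) i)

  order-bound : suc n ≤ 2 ^ ∣ C ∣ + ∣ C ∣
  order-bound = begin
    suc n                   ≡⟨ cong suc (trans (sym (∣C∣+∣∁C∣≡n C)) (ℕ.+-comm ∣ C ∣ _)) ⟩
    suc ∣ ∁ C ∣ + ∣ C ∣     ≤⟨ ℕ.+-monoˡ-≤ ∣ C ∣ (Fin.injective⇒≤ encode-injective) ⟩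
    2 ^ ∣ C ∣ + ∣ C ∣       ∎
    where
    open ℕ.≤-Reasoning
    open Inverse Fin.2↔Bool using (to; from; strictlyInverseˡ)

    encode : Fin (suc ∣ ∁ C ∣) → Fin (2 ^ ∣ C ∣)
    encode x = funToFin (from ∘ signature G C x)

    decode : Fin (2 ^ ∣ C ∣) → Fin ∣ C ∣ → Bool
    decode c i = to (finToFun c i)

    decode-encode : ∀ x i → decode (encode x) i ≡ signature G C x i
    decode-encode x i =
      trans (cong to (Fin.finToFun-funToFin (from ∘ signature G C x) i))
            (strictlyInverseˡ _)

    -- Equal codes are decoded entry by entry, giving the pointwise equality that
    -- `signature-injective` takes.
    encode-injective : Injective _≡_ _≡_ encode
    encode-injective {x} {y} eq = signature-injective x y λ i →
      trans (sym (decode-encode x i))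
        (trans (cong (λ c → decode c i) eq) (decode-encode y i))

-- With c = `∣ C ∣` below `k`, the order would be less than 2^c + c, hence less than 2^(c+1), which
-- is at most 2^k.
identifying-size : (G : Graph n) (C : Subset n) → Identifying G C →
  ∀ k → 2 ^ k ≤ n → k ≤ ∣ C ∣
identifying-size {n} G C identifying k 2^k≤n = ℕ.≮⇒≥ λ C<k → ℕ.<-irrefl refl (begin-strict
  n                           <⟨ order-bound G C identifying ⟩
  2 ^ ∣ C ∣ + ∣ C ∣           ≤⟨ ℕ.+-monoʳ-≤ (2 ^ ∣ C ∣) (ℕ.<⇒≤ (n<2^n ∣ C ∣)) ⟩
  2 ^ ∣ C ∣ + 2 ^ ∣ C ∣       ≡⟨ cong (2 ^ ∣ C ∣ +_) (ℕ.+-identityʳ _) ⟨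
  2 ^ suc ∣ C ∣               ≤⟨ ℕ.^-monoʳ-≤ 2 C<k ⟩
  2 ^ k                       ≤⟨ 2^k≤n ⟩
  n                           ∎)
  where open ℕ.≤-Reasoning

-- Completing a graph to a G^L(k).

code⇒admissible-induced : ∀ X (G : Graph n) (C : Subset n) →
  IsCode X G C → Admissible X (induced G C)
code⇒admissible-induced LD G C _ = ⊤ ,
  (λ u v u∉⊤ → contradiction ∈⊤ u∉⊤) ,
  traced⇒dominating (induced G C) ⊤ (λ v v∉⊤ → contradiction ∈⊤ v∉⊤)
-- Total domination also covers the vertices of `C`, so each has a neighbour inside the induced
-- graph.
code⇒admissible-induced LTD G C (_ , total) = ⊤ ,
  (λ u v u∉⊤ → contradiction ∈⊤ u∉⊤) , λ i →
  let w , w∈C , vw = neighbour⁻ G C (total (element C i)) in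
  neighbour⁺ (induced G C) ⊤ (rank w∈C) ∈⊤
    (trans (cong (adj G _) (element-rank w∈C)) vw)

induced-⊤ : (G : Graph n) → G ≅ induced G ⊤
induced-⊤ {n} G = record
  { vertices = mk↔ₛ′ (λ v → rank (∈⊤ {x = v})) (element ⊤)
      (λ i → element-injective (⊤ {n}) (element-rank ∈⊤)) (λ v → element-rank ∈⊤)
  ; preserve = λ u v → cong₂ (adj G) (element-rank ∈⊤) (element-rank ∈⊤)
  }

-- The new vertex is put at `zero`, so that inducing on `outside ∷ S` gives back `induced G S` by
-- computation; this lets `complete` pass `adm` and `iso` on unchanged.
attach : Graph n → Subset n → Graph (suc n)
attach G D = record
  { adj    = λ { zero zero → false ; zero (suc v) → lookup D v
               ; (suc u) zero → lookup D u ; (suc u) (suc v) → adj G u v }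
  ; symm   = λ { zero zero → refl ; zero (suc v) → refl
               ; (suc u) zero → refl ; (suc u) (suc v) → symm G u v }
  ; irrefl = λ { zero → refl ; (suc v) → irrefl G v }
  }

Missing : Graph n → Subset n → Subset n → Set
Missing G C D = D ⊆ C × Nonempty D × ¬ (∃ λ v → v ∉ C × N G v ∩ C ≡ D)

hasTrace? : (G : Graph n) (C D : Subset n) → Dec (∃ λ v → v ∉ C × N G v ∩ C ≡ D)
hasTrace? G C D = Fin.any? λ v → ¬? (v ∈? C) ×-dec ≡-dec Bool._≟_ (N G v ∩ C) D

missing? : (G : Graph n) (C : Subset n) → Dec (∃ (Missing G C))
missing? G C = anySubset? λ D → D ⊆? C ×-dec (nonempty? D ×-dec ¬? (hasTrace? G C D))

-- The new vertex lies outside `C`, so old traces keep their content; its own trace is `D`, which is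
-- non-empty and belongs to no old vertex.
attach-identifying : (G : Graph n) (C D : Subset n) → Missing G C D →
  Identifying G C → Identifying (attach G D) (outside ∷ C)
attach-identifying G C D (D⊆C , (x , x∈D) , missing) (ls , traced) = ls′ , traced′
  where
  trace-new : tabulate (lookup D) ∩ C ≡ D
  trace-new = trans (cong (_∩ C) (tabulate∘lookup D))
    (⊆-antisym (p∩q⊆p D C) (λ x∈D → x∈p∩q⁺ (x∈D , D⊆C x∈D)))

  ls′ : LocationSeparating (attach G D) (outside ∷ C)
  ls′ zero    zero    _   _   u≢v _  = u≢v refl
  ls′ zero    (suc v) _   v∉C _   eq =
    missing (v , v∉C ∘ there , trans (sym (∷-injectiveʳ eq)) trace-new)
  ls′ (suc u) zero    u∉C _   _   eq =
    missing (u , u∉C ∘ there , trans (∷-injectiveʳ eq) trace-new)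
  ls′ (suc u) (suc v) u∉C v∉C u≢v eq =
    ls u v (u∉C ∘ there) (v∉C ∘ there) (u≢v ∘ cong suc) (∷-injectiveʳ eq)

  traced′ : Traced (attach G D) (outside ∷ C)
  traced′ zero    _   = suc x , there (subst (x ∈_) (sym trace-new) x∈D)
  traced′ (suc v) v∉C = let w , w∈ = traced v (v∉C ∘ there) in suc w , there w∈

-- `S` marks the copy of `G`; its complement holds the attached vertices, later the removed set.
Completion : Kind → ℕ → Graph n → Set
Completion X k G = ∃ λ m → Σ (Graph m) λ H → Σ (Subset m) λ C → Σ (Subset m) λ S →
  IsGL k H C × C ⊆ S × Admissible X (induced H C) × G ≅ induced H S

-- Attaches a vertex for one missing trace at a time. Each attachment raises `m` by one and spends
-- one unit of fuel, keeping the bound on `m + fuel`.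
complete : ∀ X k (G : Graph n) fuel (H : Graph m) (C S : Subset m) →
  ∣ C ∣ ≡ k → 2 ^ k + k ≤ m + fuel → Identifying H C → C ⊆ S →
  Admissible X (induced H C) → G ≅ induced H S → Completion X k G
complete X k G fuel H C S size bound identifying C⊆S adm iso with missing? H C
... | no none = _ , H , C , S , gl , C⊆S , adm , iso
  where
  gl : IsGL k H C
  gl = record
    { size   = size
    ; traced = proj₂ identifying
    ; unique-trace = λ D D⊆C D≢∅ →
        let v , v∉C , eq = decidable-stable (hasTrace? H C D)
              (λ absent → none (D , D⊆C , D≢∅ , absent))
        in v , (v∉C , eq) , λ {w} (w∉C , eq′) → decidable-stable (v Fin.≟ w) λ v≢w →
             proj₁ identifying v w v∉C w∉C v≢w (trans eq (sym eq′))
    }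
-- Out of fuel, `m` is at least 2^k + k, but `order-bound` for the attached graph of order `suc m`
-- would give m + 2 ≤ 2^k + k.
complete {m = m} X k G zero H C S refl bound identifying C⊆S adm iso
  | yes (D , missing) = contradiction
    (ℕ.≤-trans bound (ℕ.≤-trans (ℕ.≤-reflexive (ℕ.+-identityʳ m)) (ℕ.n≤1+n m)))
    (ℕ.<⇒≱ (order-bound (attach H D) (outside ∷ C)
      (attach-identifying H C D missing identifying)))
complete {m = m} X k G (suc fuel) H C S size bound identifying C⊆S adm iso
  | yes (D , missing) =
    complete X k G fuel (attach H D) (outside ∷ C) (outside ∷ S) size
      (subst (2 ^ k + k ≤_) (ℕ.+-suc m fuel) bound)
      (attach-identifying H C D missing identifying)
      (s⊆s C⊆S) adm iso

-- Two vertices outside `C` with one trace are both the unique vertex with that trace.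
IsGL⇒identifying : ∀ {k} {H : Graph n} {C : Subset n} → IsGL k H C → Identifying H C
IsGL⇒identifying {H = H} {C} gl = ls , traced
  where
  open IsGL gl
  ls : LocationSeparating H C
  ls u v u∉C v∉C u≢v eq =
    let _ , _ , unique = unique-trace (N H u ∩ C) (p∩q⊆q (N H u) C) (traced u u∉C)
    in u≢v (trans (sym (unique (u∉C , refl))) (unique (v∉C , sym eq)))

≅-order : {G : Graph m} {H : Graph n} → G ≅ H → m ≤ n
≅-order iso = Fin.injective⇒≤ (λ {u} {v} eq →
  trans (sym (strictlyInverseʳ u)) (trans (cong from eq) (strictlyInverseʳ v)))
  where open Inverse (_≅_.vertices iso)

completion⇒obtainable : ∀ X k (G : Graph n) → 2 ^ k ≤ n →
  Completion X k G → ObtainableFromGL X k G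
completion⇒obtainable {n} X k G 2^k≤n (m , H , C , S , gl , C⊆S , adm , iso) =
  m , H , C , gl , adm , ∁ S , p⊆q⇒∁p⊇∁q C⊆S , few ,
  subst (λ S → G ≅ induced H S) (sym (∁-involutive S)) iso
  where
  open ℕ.≤-Reasoning
  -- The extra 1 is the empty trace counted by `order-bound`; it is what yields `k ∸ 1` instead of
  -- `k`.
  1+∣∁S∣≤k : suc ∣ ∁ S ∣ ≤ k
  1+∣∁S∣≤k = ℕ.+-cancelˡ-≤ n _ _ (begin
    n + suc ∣ ∁ S ∣       ≡⟨ ℕ.+-suc n _ ⟩
    suc (n + ∣ ∁ S ∣)     ≤⟨ s≤s (ℕ.+-monoˡ-≤ _ (≅-order iso)) ⟩
    suc (∣ S ∣ + ∣ ∁ S ∣) ≡⟨ cong suc (∣C∣+∣∁C∣≡n S) ⟩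
    suc m                 ≤⟨ order-bound H C (IsGL⇒identifying gl) ⟩
    2 ^ ∣ C ∣ + ∣ C ∣     ≡⟨ cong (λ k → 2 ^ k + k) (IsGL.size gl) ⟩
    2 ^ k + k             ≤⟨ ℕ.+-monoˡ-≤ k 2^k≤n ⟩
    n + k                 ∎)

  few : ∣ ∁ S ∣ ≤ k ∸ 1
  few = ℕ.∸-monoˡ-≤ 1 1+∣∁S∣≤k

code⇒obtainable : ∀ X k (G : Graph n) → 2 ^ k ≤ n → (C : Subset n) →
  IsCode X G C → ∣ C ∣ ≡ k → ObtainableFromGL X k G
code⇒obtainable {n} X k G 2^k≤n C code size = completion⇒obtainable X k G 2^k≤n
  (complete X k G (2 ^ k + k) G C ⊤ size (ℕ.m≤n+m _ n)
    (code⇒identifying X G C code) ⊆⊤ (code⇒admissible-induced X G C code) (induced-⊤ G))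

-- Transporting a code back along the removal.

module Pullback {G : Graph n} {H : Graph m} {C S : Subset m}
                (C⊆S : C ⊆ S) (iso : G ≅ induced H S) where

  open Inverse (_≅_.vertices iso) using (to; from; strictlyInverseˡ; strictlyInverseʳ)

  embed : Fin n → Fin m
  embed v = element S (to v)

  embed-injective : Injective _≡_ _≡_ embed
  embed-injective {u} {v} eq = trans (sym (strictlyInverseʳ u))
    (trans (cong from (element-injective S eq)) (strictlyInverseʳ v))

  -- Since `C ⊆ S`, every vertex of `C` survives in `G`, so traces on `C` carry over in full.
  lift : ∀ {w} → w ∈ C → Fin n
  lift w∈C = from (rank (C⊆S w∈C))

  embed-lift : ∀ {w} (w∈C : w ∈ C) → embed (lift w∈C) ≡ w
  embed-lift w∈C = trans (cong (element S) (strictlyInverseˡ _)) (element-rank (C⊆S w∈C))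

  pullback : Subset n
  pullback = tabulate (lookup C ∘ embed)

  ∈-pullback⁺ : ∀ {v} → embed v ∈ C → v ∈ pullback
  ∈-pullback⁺ {v} v∈ =
    lookup⇒[]= v _ (trans (lookup∘tabulate (lookup C ∘ embed) v) ([]=⇒lookup v∈))

  ∈-pullback⁻ : ∀ {v} → v ∈ pullback → embed v ∈ C
  ∈-pullback⁻ {v} v∈ =
    lookup⇒[]= _ C (trans (sym (lookup∘tabulate (lookup C ∘ embed) v)) ([]=⇒lookup v∈))

  -- An upper bound suffices, as `identifying-size` supplies the lower one.
  pullback-size : ∣ pullback ∣ ≤ ∣ C ∣
  pullback-size = Fin.injective⇒≤ {f = restrict} λ {i} {j} eq →
    element-injective pullback (embed-injective
      (trans (sym (element-rank _)) (trans (cong (element C) eq) (element-rank _))))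
    where
    restrict : Fin ∣ pullback ∣ → Fin ∣ C ∣
    restrict i = rank (∈-pullback⁻ (element-∈ pullback i))

  adj-lift : ∀ u {w} (w∈C : w ∈ C) → adj G u (lift w∈C) ≡ adj H (embed u) w
  adj-lift u w∈C =
    trans (sym (_≅_.preserve iso u (lift w∈C))) (cong (adj H (embed u)) (embed-lift w∈C))

  lift-∈ : ∀ {w} (w∈C : w ∈ C) → lift w∈C ∈ pullback
  lift-∈ w∈C = ∈-pullback⁺ (subst (_∈ C) (sym (embed-lift w∈C)) w∈C)

  neighbour-pullback : ∀ v → Nonempty (N H (embed v) ∩ C) → Nonempty (N G v ∩ pullback)
  neighbour-pullback v ne with neighbour⁻ H C ne
  ... | w , w∈C , vw =
    neighbour⁺ G pullback (lift w∈C) (lift-∈ w∈C) (trans (adj-lift v w∈C) vw)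

  pullback-identifying : Identifying H C → Identifying G pullback
  pullback-identifying (ls , traced) = ls′ , traced′
    where
    ls′ : LocationSeparating G pullback
    ls′ u v u∉ v∉ u≢v eq =
      ls (embed u) (embed v) (u∉ ∘ ∈-pullback⁺) (v∉ ∘ ∈-pullback⁺) (u≢v ∘ embed-injective)
        (trace-cong H C λ w∈C → trans (sym (adj-lift u w∈C))
          (trans (trace-≡⇒adj-≡ G pullback eq (lift-∈ w∈C)) (adj-lift v w∈C)))

    traced′ : Traced G pullback
    traced′ v v∉ = neighbour-pullback v (traced (embed v) (v∉ ∘ ∈-pullback⁺))

  pullback-code : ∀ X → Identifying H C → Admissible X (induced H C) → IsCode X G pullback
  pullback-code LD identifying _ with pullback-identifying identifying
  ... | ls , traced = ls , traced⇒dominating G pullback traced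
  pullback-code LTD identifying (D , _ , total) =
    proj₁ (pullback-identifying identifying) , λ v → neighbour-pullback v (neighbour v)
    where
    neighbour : ∀ v → Nonempty (N H (embed v) ∩ C)
    neighbour v with embed v ∈? C
    ... | no  v∉C = proj₂ identifying (embed v) v∉C
    -- A vertex of `C` gets its neighbour from the LTD-code `D` of `induced H C`, whose elements are
    -- vertices of `C`.
    ... | yes v∈C with neighbour⁻ (induced H C) D (total (rank v∈C))
    ... | j , _ , vj = neighbour⁺ H C (element C j) (element-∈ C j)
          (trans (cong (λ u → adj H u (element C j)) (sym (element-rank v∈C))) vj)

-- The equivalence.

obtainable⇒code : ∀ X k (G : Graph n) → ObtainableFromGL X k G →
  ∃ λ D → IsCode X G D × ∣ D ∣ ≤ k
obtainable⇒code X k G (m , H , C , gl , adm , R , R⊆∁C , _ , iso) =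
  pullback , pullback-code X (IsGL⇒identifying gl) adm ,
  ℕ.≤-trans pullback-size (ℕ.≤-reflexive (IsGL.size gl))
  where
  open Pullback {H = H} {C = C} (λ x∈C → x∉p⇒x∈∁p λ x∈R → x∈∁p⇒x∉p (R⊆∁C x∈R) x∈C) iso

theorem2 : (X : Kind) (n : ℕ) (G : Graph n) (adm : Admissible X G)
    (k : ℕ) → k ≡ ⌊log₂ n ⌋ → 2 ≤ k →
    γ X G adm ≡ k ⇔ ObtainableFromGL X k G
theorem2 X n G adm k k≡log 2≤k = mk⇔ forward backward
  where
  2^k≤n : 2 ^ k ≤ n
  2^k≤n = 2^⌊log₂n⌋≤n k n k≡log (ℕ.<⇒≤ 2≤k)

  γ-minimum : IsMinimumCodeSize X G (γ X G adm)
  γ-minimum = proj₂ (minimumCodeSize X G adm)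

  forward : γ X G adm ≡ k → ObtainableFromGL X k G
  forward γ≡k with proj₁ γ-minimum
  ... | C , code , size = code⇒obtainable X k G 2^k≤n C code (trans size γ≡k)

  backward : ObtainableFromGL X k G → γ X G adm ≡ k
  -- `D` bounds the minimum above by `k`; a minimum code `C` is identifying, so it has at least `k`
  -- vertices.
  backward obtainable with obtainable⇒code X k G obtainable | proj₁ γ-minimum
  ... | D , code , D≤k | C , code′ , size = ℕ.≤-antisym
    (ℕ.≤-trans (proj₂ γ-minimum D code) D≤k)
    (subst (k ≤_) size
      (identifying-size G C (code⇒identifying X G C code′) k 2^k≤n))
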